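{- Let $w\ge 4$ be an even integer, and set $u=w-2$, $v=w-1$. Then $$\sum_{\substack{a+c=w-1\\ a\ge 2,\ c\ge 1}}(-1)^a\,\zeta(a,1,c)=\zeta(u,2)-\zeta(v,1)+\frac12\zeta(w).$$
   Context: Multiple zeta values: for positive integers $s_1\ge2, s_2,\dots,s_d$, $\zeta(s_1,\dots,s_d)=\sum_{k_1>\cdots>k_d>0}k_1^{ -s_1}\cdots k_d^{ -s_d}$. The sum is over positive integers $a,c$. -}

module Defs where

open import Data.Nat as ℕ using (ℕ; zero; suc; _^_; _∸_)
open import Data.Nat.Properties using (m^n≢0)
open import Data.Integer as ℤ using (+_)
open import Data.List using (List; []; _∷_)
open import Data.Rational using (ℚ; _/_; _+_; _*_; _-_; -_; 0ℚ; 1ℚ)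

invPow : (m s : ℕ) → ℚ
invPow m s = _/_ (+ 1) (suc m ^ s) {{m^n≢0 (suc m) s}}

-- Truncated multiple zeta value:
--   zetaTr N (s₁ ∷ … ∷ s_d ∷ [])  =  Σ_{N ≥ k₁ > k₂ > … > k_d > 0}  k₁^{-s₁} ⋯ k_d^{-s_d}
-- zetaTr N ss  =  Σ_{k=1}^{N} k^{-s} · zetaTr (k-1) ss  for the list s ∷ ss.
zetaTr : ℕ → List ℕ → ℚ
zetaTr N [] = 1ℚ
zetaTr zero (s ∷ ss) = 0ℚ
zetaTr (suc n) (s ∷ ss) = zetaTr n (s ∷ ss) + invPow n s * zetaTr n ss

signQ : ℕ → ℚ
signQ zero = 1ℚ
signQ (suc a) = - signQ a

-- Σ_{a=2}^{b+1} f a   (i.e. sum over 2 ≤ a ≤ b+1)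
sumFrom2 : ℕ → (ℕ → ℚ) → ℚ
sumFrom2 zero f = 0ℚ
sumFrom2 (suc b) f = sumFrom2 b f + f (suc (suc b))

-- Truncation at N of the left-hand side:
--   Σ_{a+c=w-1, a≥2, c≥1} (-1)^a ζ(a,1,c),  i.e. a ranges over 2 ≤ a ≤ w-2, c = w-1-a.
lhsTr : (w N : ℕ) → ℚ
lhsTr w N = sumFrom2 (w ∸ 3) (λ a → signQ a * zetaTr N (a ∷ 1 ∷ (w ∸ 1 ∸ a) ∷ []))

rhsTr : (w N : ℕ) → ℚ
rhsTr w N = (zetaTr N ((w ∸ 2) ∷ 2 ∷ []) - zetaTr N ((w ∸ 1) ∷ 1 ∷ []))
            + (+ 1 / 2) * zetaTr N (w ∷ [])

{-# OPTIONS --safe #-}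
module Submission where

-- For k > m the alternating sum over a of k^{-a} m^{-c} is geometric, and w being even it equals
--   (k^{-1} m^{-(u-1)} + k^{-u}) / (k + m).
-- Collecting the coefficient of m^{-u} on both sides leaves, for every single m, the identity
--   Σ_{k>l>m} m/(l k (k+m)) + Σ_{m>l>j} 1/(l (m+j))  =  Σ_{j<m} 1/j² - (1/m) Σ_{j<m} 1/j + 1/(2m²).
-- The infinite sum telescopes to Σ_{j≤i≤m} 1/(i (m+j)), after which the identity is proved by
-- induction on m from 1/(xy) = (1/x + 1/y)/(x+y).  Truncating at N, the two sides of the theorem
-- differ exactly by Σ_{m≤N} m^{-u} R N m, where R N m ≥ 0 is the tail k > N of the infinite sum;
-- this is at most (1 + H_N)² / N, which tends to 0.

open import Defs
open import Data.Nat as ℕ using (ℕ; zero; suc; z≤n; s≤s)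
import Data.Nat.Properties as ℕ
open import Data.Nat.Divisibility using (_∣_; divides)
open import Data.Integer as ℤ using (+_; -[1+_])
import Data.Integer.Properties as ℤ
open import Data.List using ([]; _∷_)
open import Data.Product using (∃; _,_)
open import Data.Rational
open import Data.Rational.Properties
open import Data.Rational.Solver using (module +-*-Solver)
import Data.Rational.Unnormalised as ℚᵘ
import Data.Rational.Unnormalised.Properties as ℚᵘ
open import Relation.Binary.PropositionalEquality
open +-*-Solver

-- Unit fractions

fromℚᵘ-homo-+ : ∀ p q → fromℚᵘ (p ℚᵘ.+ q) ≡ fromℚᵘ p + fromℚᵘ q
fromℚᵘ-homo-+ p q = toℚᵘ-injective (ℚᵘ.≃-trans (toℚᵘ-fromℚᵘ (p ℚᵘ.+ q))
  (ℚᵘ.≃-sym (ℚᵘ.≃-trans (toℚᵘ-homo-+ (fromℚᵘ p) (fromℚᵘ q))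
    (ℚᵘ.+-cong (toℚᵘ-fromℚᵘ p) (toℚᵘ-fromℚᵘ q)))))

fromℚᵘ-homo-* : ∀ p q → fromℚᵘ (p ℚᵘ.* q) ≡ fromℚᵘ p * fromℚᵘ q
fromℚᵘ-homo-* p q = toℚᵘ-injective (ℚᵘ.≃-trans (toℚᵘ-fromℚᵘ (p ℚᵘ.* q))
  (ℚᵘ.≃-sym (ℚᵘ.≃-trans (toℚᵘ-homo-* (fromℚᵘ p) (fromℚᵘ q))
    (ℚᵘ.*-cong (toℚᵘ-fromℚᵘ p) (toℚᵘ-fromℚᵘ q)))))

*-unitFraction : ∀ m n .{{_ : ℕ.NonZero m}} .{{_ : ℕ.NonZero n}} .{{_ : ℕ.NonZero (m ℕ.* n)}} →
  + 1 / (m ℕ.* n) ≡ (+ 1 / m) * (+ 1 / n)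
*-unitFraction (suc m) (suc n) = fromℚᵘ-homo-* (ℚᵘ.mkℚᵘ (+ 1) m) (ℚᵘ.mkℚᵘ (+ 1) n)

-- Opaque, so that `r` and `ι` never unfold into normalised fractions: later proofs treat them as
-- atoms governed by the facts of this block.
abstract
  -- The index is shifted by one, as in invPow.
  r : ℕ → ℚ
  r n = + 1 / suc n

  ι : ℕ → ℚ
  ι n = + n / 1

  r-zero : r 0 ≡ 1ℚ
  r-zero = refl

  ι-zero : ι 0 ≡ 0ℚ
  ι-zero = refl

  ι-homo-+ : ∀ m n → ι (m ℕ.+ n) ≡ ι m + ι n
  ι-homo-+ m n = trans
    (fromℚᵘ-cong {ℚᵘ.mkℚᵘ (+ (m ℕ.+ n)) 0} {ℚᵘ.mkℚᵘ (+ m) 0 ℚᵘ.+ ℚᵘ.mkℚᵘ (+ n) 0}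
      (ℚᵘ.*≡* (cong (ℤ._* + 1) (cong₂ ℤ._+_ (sym (ℤ.*-identityʳ (+ m))) (sym (ℤ.*-identityʳ (+ n)))))))
    (fromℚᵘ-homo-+ (ℚᵘ.mkℚᵘ (+ m) 0) (ℚᵘ.mkℚᵘ (+ n) 0))

  ι-suc : ∀ n → ι (suc n) ≡ 1ℚ + ι n
  ι-suc n = ι-homo-+ 1 n

  r*ι≡1 : ∀ n → r n * ι (suc n) ≡ 1ℚ
  r*ι≡1 n = trans (sym (fromℚᵘ-homo-* (ℚᵘ.mkℚᵘ (+ 1) n) (ℚᵘ.mkℚᵘ (+ suc n) 0)))
    (fromℚᵘ-cong {ℚᵘ.mkℚᵘ (+ 1) n ℚᵘ.* ℚᵘ.mkℚᵘ (+ suc n) 0} {ℚᵘ.1ℚᵘ}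
      (ℚᵘ.*≡* (ℤ.*-assoc (+ 1) (+ suc n) (+ 1))))

  invPow-suc : ∀ n s → invPow n (suc s) ≡ r n * invPow n s
  invPow-suc n s = *-unitFraction (suc n) (suc n ℕ.^ s) {{_}} {{ℕ.m^n≢0 (suc n) s}} {{ℕ.m^n≢0 (suc n) (suc s)}}

  r≥0 : ∀ n → 0ℚ ≤ r n
  r≥0 n = nonNegative⁻¹ (r n) {{normalize-nonNeg 1 (suc n)}}

  ι≥0 : ∀ n → 0ℚ ≤ ι n
  ι≥0 n = nonNegative⁻¹ (ι n) {{normalize-nonNeg n 1}}

  -- A nonnegative fraction is at most its numerator, a negative one at most 0.
  ≤ι : ∀ q → ∃ λ k → q ≤ ι k
  ≤ι q@(mkℚ (+ k) d _) = k , toℚᵘ-cancel-≤ (ℚᵘ.≤-respʳ-≃ (ℚᵘ.≃-sym (toℚᵘ-fromℚᵘ (ℚᵘ.mkℚᵘ (+ k) 0)))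
    (ℚᵘ.*≤* (ℤ.*-monoˡ-≤-nonNeg (+ k) (ℤ.+≤+ (s≤s z≤n)))))
  ≤ι q@(mkℚ -[1+ _ ] _ _) = 0 , <⇒≤ (negative⁻¹ q)

-- Indices being shifted, `a + suc b` stands for p + q with p = a+1 and q = b+1, so this is 1/(pq) =
-- (1/p + 1/q)/(p+q). The cancellations in `altGeometric`, `A-suc`, `A-diagonal` and
-- `rhsTr≡lhsTr+error` rest on it.
partialFraction : ∀ a b → r a * r b ≡ r (a ℕ.+ suc b) * (r a + r b)
partialFraction a b = begin
  x * y                                ≡⟨ solve 2 (λ x y → x :* y := con 1ℚ :* (x :* y)) refl x y ⟩
  1ℚ * (x * y)                         ≡⟨ cong (_* (x * y)) (sym (r*ι≡1 (a ℕ.+ suc b))) ⟩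
  t * ι (suc a ℕ.+ suc b) * (x * y)    ≡⟨ cong (λ z → t * z * (x * y)) (ι-homo-+ (suc a) (suc b)) ⟩
  t * (p + q) * (x * y)                ≡⟨ solve 5 (λ t p q x y → t :* (p :+ q) :* (x :* y)
                                            := t :* (x :* (y :* q) :+ (x :* p) :* y)) refl t p q x y ⟩
  t * (x * (y * q) + (x * p) * y)      ≡⟨ cong₂ (λ u v → t * (x * u + v * y)) (r*ι≡1 b) (r*ι≡1 a) ⟩
  t * (x * 1ℚ + 1ℚ * y)                ≡⟨ cong (t *_) (cong₂ _+_ (*-identityʳ x) (*-identityˡ y)) ⟩
  t * (x + y)                          ∎
  where
  open ≡-Reasoning
  x = r a ; y = r b ; t = r (a ℕ.+ suc b) ; p = ι (suc a) ; q = ι (suc b)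

invPow-1 : ∀ n → invPow n 1 ≡ r n
invPow-1 n = trans (invPow-suc n 0) (*-identityʳ (r n))

-- Finite sums

∑ : ℕ → (ℕ → ℚ) → ℚ
∑ zero    f = 0ℚ
∑ (suc n) f = ∑ n f + f n

∑-cong : ∀ {f g} → (∀ i → f i ≡ g i) → ∀ n → ∑ n f ≡ ∑ n g
∑-cong f≡g zero    = refl
∑-cong f≡g (suc n) = cong₂ _+_ (∑-cong f≡g n) (f≡g n)

∑-head : ∀ f n → ∑ (suc n) f ≡ f 0 + ∑ n (λ i → f (suc i))
∑-head f zero    = +-comm 0ℚ (f 0)
∑-head f (suc n) = trans (cong (_+ f (suc n)) (∑-head f n)) (+-assoc (f 0) _ (f (suc n)))

∑-linear : ∀ c f g n → ∑ n (λ i → f i + c * g i) ≡ ∑ n f + c * ∑ n g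
∑-linear c f g zero    = solve 1 (λ c → con 0ℚ := con 0ℚ :+ c :* con 0ℚ) refl c
∑-linear c f g (suc n) = trans (cong (_+ (f n + c * g n)) (∑-linear c f g n))
  (solve 5 (λ F c G x y → F :+ c :* G :+ (x :+ c :* y) := F :+ x :+ c :* (G :+ y)) refl
    (∑ n f) c (∑ n g) (f n) (g n))

H : ℕ → ℚ
H n = ∑ n r

H₂ : ℕ → ℚ
H₂ n = ∑ n (λ i → r i * r i)

-- Interchange of summation: `g m` collects `r l` from every l with m < l < n, and these add up to
-- `H n - H (suc m)`.
∑-harmonicWeights : ∀ g n → ∑ n (λ l → r l * ∑ l g) ≡ ∑ n (λ m → (H n - H (suc m)) * g m)
∑-harmonicWeights g zero    = refl
∑-harmonicWeights g (suc n) = begin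
  ∑ n (λ l → r l * ∑ l g) + r n * ∑ n g
    ≡⟨ cong (_+ r n * ∑ n g) (∑-harmonicWeights g n) ⟩
  ∑ n (λ m → (H n - H (suc m)) * g m) + r n * ∑ n g
    ≡⟨ sym (∑-linear (r n) (λ m → (H n - H (suc m)) * g m) g n) ⟩
  ∑ n (λ m → (H n - H (suc m)) * g m + r n * g m)
    ≡⟨ ∑-cong (λ m → solve 4 (λ h h' x y → (h :- h') :* y :+ x :* y := (h :+ x :- h') :* y) refl
         (H n) (H (suc m)) (r n) (g m)) n ⟩
  ∑ n (λ m → (H (suc n) - H (suc m)) * g m)
    -- The index m = n joins the range with weight zero.
    ≡⟨ solve 3 (λ s h y → s := s :+ (h :- h) :* y) refl _ (H (suc n)) (g n) ⟩
  ∑ (suc n) (λ m → (H (suc n) - H (suc m)) * g m) ∎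
  where open ≡-Reasoning

-- Truncated zeta values as finite sums

zetaTr-depth1 : ∀ n s → zetaTr n (s ∷ []) ≡ ∑ n (λ m → invPow m s)
zetaTr-depth1 zero    s = refl
zetaTr-depth1 (suc n) s = cong₂ _+_ (zetaTr-depth1 n s) (*-identityʳ (invPow n s))

zetaTr-1 : ∀ n → zetaTr n (1 ∷ []) ≡ H n
zetaTr-1 n = trans (zetaTr-depth1 n 1) (∑-cong invPow-1 n)

zetaTr-2 : ∀ n → zetaTr n (2 ∷ []) ≡ H₂ n
zetaTr-2 n = trans (zetaTr-depth1 n 2)
  (∑-cong (λ m → trans (invPow-suc m 1) (cong (r m *_) (invPow-1 m))) n)

-- The middle exponent 1 becomes harmonic weights free of `c`, which can therefore be pulled out of
-- the sum over a.
zetaTr-1-c : ∀ n c → zetaTr n (1 ∷ c ∷ []) ≡ ∑ n (λ m → (H n - H (suc m)) * invPow m c)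
zetaTr-1-c n c = trans (nested n) (∑-harmonicWeights (λ m → invPow m c) n)
  where
  nested : ∀ n → zetaTr n (1 ∷ c ∷ []) ≡ ∑ n (λ l → r l * ∑ l (λ m → invPow m c))
  nested zero    = refl
  nested (suc n) = cong₂ _+_ (nested n) (cong₂ _*_ (invPow-1 n) (zetaTr-depth1 n c))

-- The alternating sum over a

-- With K = k+1 and M = m+1 this is a geometric progression of ratio -M/K, so only its two boundary
-- terms survive, over K + M. Leaving the upper end `d` free permits induction, each new term being
-- absorbed by `partialFraction`; `d ≤ b` keeps the exponents `b ∸ d` exact.
altGeometric : ∀ k m b d → d ℕ.≤ b →
  sumFrom2 d (λ a → signQ a * (invPow k a * invPow m (suc (suc b) ℕ.∸ a)))
    ≡ r (k ℕ.+ suc m) * (r k * invPow m b + signQ (suc d) * (invPow k (suc d) * invPow m (b ℕ.∸ d)))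
-- The empty sum: the two boundary terms cancel, `signQ 1` being -1.
altGeometric k m b zero    _   = trans
  (solve 3 (λ t x y → con 0ℚ := t :* (x :* y :+ (:- con 1ℚ) :* (x :* y))) refl
    (r (k ℕ.+ suc m)) (r k) (invPow m b))
  (cong (λ z → r (k ℕ.+ suc m) * (r k * invPow m b + signQ 1 * (z * invPow m b))) (sym (invPow-1 k)))
altGeometric k m b (suc d) d<b = begin
  sumFrom2 d term + - s * (invPow k (suc (suc d)) * invPow m (b ℕ.∸ d))
    ≡⟨ cong₂ _+_ (altGeometric k m b d (ℕ.<⇒≤ d<b))
         (cong (λ z → - s * (z * invPow m (b ℕ.∸ d))) (invPow-suc k (suc d))) ⟩
  t * (x * yᵇ + s * (X * invPow m (b ℕ.∸ d))) + - s * (x * X * invPow m (b ℕ.∸ d))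
    ≡⟨ cong (λ z → t * (x * yᵇ + s * (X * z)) + - s * (x * X * z)) splitPower ⟩
  t * (x * yᵇ + s * (X * (y * Y))) + - s * (x * X * (y * Y))
    ≡⟨ solve 7 (λ t x y s X Y z → t :* (x :* z :+ s :* (X :* (y :* Y))) :+ (:- s) :* (x :* X :* (y :* Y))
         := t :* (x :* z :+ s :* (X :* (y :* Y))) :+ (:- s) :* (X :* Y) :* (x :* y))
         refl t x y s X Y yᵇ ⟩
  t * (x * yᵇ + s * (X * (y * Y))) + - s * (X * Y) * (x * y)
    ≡⟨ cong (λ z → t * (x * yᵇ + s * (X * (y * Y))) + - s * (X * Y) * z) (partialFraction k m) ⟩
  t * (x * yᵇ + s * (X * (y * Y))) + - s * (X * Y) * (t * (x + y))
    ≡⟨ solve 7 (λ t x y s X Y z → t :* (x :* z :+ s :* (X :* (y :* Y))) :+ (:- s) :* (X :* Y) :* (t :* (x :+ y))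
         := t :* (x :* z :+ (:- s) :* (x :* X :* Y)))
         refl t x y s X Y yᵇ ⟩
  t * (x * yᵇ + - s * (x * X * Y))
    ≡⟨ cong (λ z → t * (x * yᵇ + - s * (z * Y))) (sym (invPow-suc k (suc d))) ⟩
  t * (x * yᵇ + - s * (invPow k (suc (suc d)) * Y)) ∎
  where
  open ≡-Reasoning
  term : ℕ → ℚ
  term a = signQ a * (invPow k a * invPow m (suc (suc b) ℕ.∸ a))
  t = r (k ℕ.+ suc m) ; x = r k ; y = r m ; yᵇ = invPow m b
  s = signQ (suc d) ; X = invPow k (suc d) ; Y = invPow m (b ℕ.∸ suc d)
  splitPower : invPow m (b ℕ.∸ d) ≡ y * Y
  splitPower = trans (cong (invPow m) (ℕ.+-∸-assoc 1 d<b)) (invPow-suc m (b ℕ.∸ suc d))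

sumFrom2-cong : ∀ {f g} → (∀ a → f a ≡ g a) → ∀ b → sumFrom2 b f ≡ sumFrom2 b g
sumFrom2-cong f≡g zero    = refl
sumFrom2-cong f≡g (suc b) = cong₂ _+_ (sumFrom2-cong f≡g b) (f≡g (suc (suc b)))

-- Interchanges the sums over a and m. `Z` holds the value at the previous truncation, `X` the power
-- of the new outermost index, and `g` the weights independent of a.
sumFrom2-∑-swap : ∀ (s Z X : ℕ → ℚ) (Y : ℕ → ℕ → ℚ) (g : ℕ → ℚ) n b →
  sumFrom2 b (λ a → s a * (Z a + X a * ∑ n (λ m → g m * Y a m)))
    ≡ sumFrom2 b (λ a → s a * Z a) + ∑ n (λ m → g m * sumFrom2 b (λ a → s a * (X a * Y a m)))
sumFrom2-∑-swap s Z X Y g n zero    = sym (trans (+-identityˡ _) (∑-zero n))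
  where
  ∑-zero : ∀ n → ∑ n (λ m → g m * 0ℚ) ≡ 0ℚ
  ∑-zero zero    = refl
  ∑-zero (suc n) = cong₂ _+_ (∑-zero n) (*-zeroʳ (g n))
sumFrom2-∑-swap s Z X Y g n (suc b) = begin
  sumFrom2 b (λ a → s a * (Z a + X a * ∑ n (λ m → g m * Y a m))) + s c * (Z c + X c * S)
    ≡⟨ cong (_+ s c * (Z c + X c * S)) (sumFrom2-∑-swap s Z X Y g n b) ⟩
  F + ∑ n inner + s c * (Z c + X c * S)
    ≡⟨ solve 6 (λ F G s z x S → F :+ G :+ s :* (z :+ x :* S) := F :+ s :* z :+ (G :+ s :* x :* S)) refl
         F (∑ n inner) (s c) (Z c) (X c) S ⟩
  F + s c * Z c + (∑ n inner + s c * X c * S)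
    ≡⟨ cong (λ z → F + s c * Z c + z) (sym (∑-linear (s c * X c) inner (λ m → g m * Y c m) n)) ⟩
  F + s c * Z c + ∑ n (λ m → inner m + s c * X c * (g m * Y c m))
    ≡⟨ cong (λ z → F + s c * Z c + z) (∑-cong (λ m →
         solve 5 (λ g G s x y → g :* G :+ s :* x :* (g :* y) := g :* (G :+ s :* (x :* y))) refl
           (g m) (sumFrom2 b (λ a → s a * (X a * Y a m))) (s c) (X c) (Y c m)) n) ⟩
  F + s c * Z c + ∑ n (λ m → g m * (sumFrom2 b (λ a → s a * (X a * Y a m)) + s c * (X c * Y c m))) ∎
  where
  open ≡-Reasoning
  c = suc (suc b)
  S = ∑ n (λ m → g m * Y c m)
  F = sumFrom2 b (λ a → s a * Z a)
  inner : ℕ → ℚ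
  inner m = g m * sumFrom2 b (λ a → s a * (X a * Y a m))

-- Here w = 3 + b, so u = b + 1 and the hypothesis says that u is even. The new terms are those with
-- outermost index n + 1; for each m their sum over a is the complete progression, `altGeometric` at
-- d = b.
lhsTr-suc : ∀ b → signQ (suc b) ≡ 1ℚ → ∀ n → lhsTr (3 ℕ.+ b) (suc n) ≡ lhsTr (3 ℕ.+ b) n +
  ∑ n (λ m → (H n - H (suc m)) * (r (n ℕ.+ suc m) * (r n * invPow m b + invPow n (suc b))))
lhsTr-suc b even n = begin
  lhsTr (3 ℕ.+ b) (suc n)
    ≡⟨ sumFrom2-cong (λ a → cong (λ z → signQ a * (zetaTr n (a ∷ 1 ∷ (suc (suc b) ℕ.∸ a) ∷ []) + invPow n a * z))
         (zetaTr-1-c n (suc (suc b) ℕ.∸ a))) b ⟩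
  sumFrom2 b (λ a → signQ a * (zetaTr n (a ∷ 1 ∷ (suc (suc b) ℕ.∸ a) ∷ []) +
    invPow n a * ∑ n (λ m → (H n - H (suc m)) * invPow m (suc (suc b) ℕ.∸ a))))
    ≡⟨ sumFrom2-∑-swap signQ (λ a → zetaTr n (a ∷ 1 ∷ (suc (suc b) ℕ.∸ a) ∷ [])) (invPow n)
         (λ a m → invPow m (suc (suc b) ℕ.∸ a)) (λ m → H n - H (suc m)) n b ⟩
  lhsTr (3 ℕ.+ b) n + ∑ n (λ m → (H n - H (suc m)) *
    sumFrom2 b (λ a → signQ a * (invPow n a * invPow m (suc (suc b) ℕ.∸ a))))
    ≡⟨ cong (λ z → lhsTr (3 ℕ.+ b) n + z) (∑-cong (λ m → cong ((H n - H (suc m)) *_) (closed m)) n) ⟩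
  _ ∎
  where
  open ≡-Reasoning
  closed : ∀ m → sumFrom2 b (λ a → signQ a * (invPow n a * invPow m (suc (suc b) ℕ.∸ a)))
    ≡ r (n ℕ.+ suc m) * (r n * invPow m b + invPow n (suc b))
  closed m = trans (altGeometric n m b b ℕ.≤-refl)
    (cong (λ z → r (n ℕ.+ suc m) * (r n * invPow m b + z))
      (trans (cong₂ (λ s e → s * (invPow n (suc b) * invPow m e)) even (ℕ.n∸n≡0 b))
        (solve 1 (λ x → con 1ℚ :* (x :* con 1ℚ) := x) refl (invPow n (suc b)))))

-- The remainder

-- The harmonic block 1/(n+1) + ... + 1/(n+m).
B : ℕ → ℕ → ℚ
B n m = ∑ m (λ j → r (n ℕ.+ j))

-- In unshifted indices, the sum of 1/(i (n+j)) over 1 ≤ j ≤ i ≤ m.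
A : ℕ → ℕ → ℚ
A n m = ∑ m (λ i → r i * B n (suc i))

-- A closed form of the tail  Σ_{k > n} Σ_{k > l > m} m / (l k (k + m)).
R : ℕ → ℕ → ℚ
R n m = A n m + (H n - H m) * B n m

B-shift : ∀ n m → B n (suc m) ≡ r n + B (suc n) m
B-shift n m = trans (∑-head (λ j → r (n ℕ.+ j)) m)
  (cong₂ _+_ (cong r (ℕ.+-identityʳ n)) (∑-cong (λ j → cong r (ℕ.+-suc n j)) m))

B-suc : ∀ n m → B (suc n) m ≡ B n m + (r (n ℕ.+ m) - r n)
B-suc n m = begin
  B (suc n) m                    ≡⟨ solve 2 (λ b x → b := x :+ b :- x) refl (B (suc n) m) (r n) ⟩
  r n + B (suc n) m - r n        ≡⟨ cong (_- r n) (sym (B-shift n m)) ⟩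
  B n m + r (n ℕ.+ m) - r n      ≡⟨ +-assoc (B n m) (r (n ℕ.+ m)) (- r n) ⟩
  B n m + (r (n ℕ.+ m) - r n)    ∎
  where open ≡-Reasoning

-- By `B-suc` the block of length i changes by 1/(n+1+i) - 1/(n+1); divided by i this is
-- -1/((n+1)(n+1+i)), and summing over i ≤ m gives the block `B (suc n) m`.
A-suc : ∀ n m → A (suc n) m ≡ A n m - r n * B (suc n) m
A-suc n zero    = solve 1 (λ x → con 0ℚ := con 0ℚ :- x :* con 0ℚ) refl (r n)
A-suc n (suc m) = begin
  A (suc n) m + y * B (suc n) (suc m)
    ≡⟨ cong₂ (λ a b → a + y * b) (A-suc n m) (B-suc n (suc m)) ⟩
  A n m - x * β + y * (B n (suc m) + (t - x))
    ≡⟨ solve 6 (λ α β β' x y t → α :- x :* β :+ y :* (β' :+ (t :- x))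
         := α :+ y :* β' :- x :* β :+ (y :* t :- x :* y)) refl (A n m) β (B n (suc m)) x y t ⟩
  A n m + y * B n (suc m) - x * β + (y * t - x * y)
    ≡⟨ cong (λ z → A n m + y * B n (suc m) - x * β + (y * t - z)) (partialFraction n m) ⟩
  A n m + y * B n (suc m) - x * β + (y * t - t * (x + y))
    ≡⟨ solve 5 (λ α β x y t → α :- x :* β :+ (y :* t :- t :* (x :+ y)) := α :- x :* (β :+ t)) refl
         (A n (suc m)) β x y t ⟩
  A n (suc m) - x * (β + t)
    ≡⟨ cong (λ z → A n (suc m) - x * (β + r z)) (ℕ.+-suc n m) ⟩
  A n (suc m) - x * B (suc n) (suc m) ∎
  where
  open ≡-Reasoning
  x = r n ; y = r m ; t = r (n ℕ.+ suc m) ; β = B (suc n) m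

-- The tail loses its term k = n+1, since m/(k(k+m)) = 1/k - 1/(k+m). The correction from `A-suc`
-- cancels against the growth of `H n`.
R-suc : ∀ n m → R (suc n) m ≡ R n m + (H n - H m) * (r (n ℕ.+ m) - r n)
R-suc n m = begin
  A (suc n) m + (H n + x - H m) * B (suc n) m
    ≡⟨ cong (_+ (H n + x - H m) * B (suc n) m) (A-suc n m) ⟩
  A n m - x * B (suc n) m + (H n + x - H m) * B (suc n) m
    ≡⟨ solve 5 (λ α β x h h' → α :- x :* β :+ (h :+ x :- h') :* β := α :+ (h :- h') :* β) refl
         (A n m) (B (suc n) m) x (H n) (H m) ⟩
  A n m + (H n - H m) * B (suc n) m
    ≡⟨ cong (λ z → A n m + (H n - H m) * z) (B-suc n m) ⟩
  A n m + (H n - H m) * (B n m + (t - x))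
    ≡⟨ solve 5 (λ α h h' β t → α :+ (h :- h') :* (β :+ t) := α :+ (h :- h') :* β :+ (h :- h') :* t) refl
         (A n m) (H n) (H m) (B n m) (t - x) ⟩
  R n m + (H n - H m) * (t - x) ∎
  where
  open ≡-Reasoning
  x = r n ; t = r (n ℕ.+ m)

-- Lengthening and then shifting adds x (x - t), where x = 1/(n+1) and t = 1/(2n+2) = x/2, hence
-- x²/2. This is the origin of the coefficient ½ of ζ(w).
A-diagonal : ∀ n → A n n ≡ (+ 1 / 2) * H₂ n
A-diagonal zero    = refl
A-diagonal (suc n) = begin
  A (suc n) (suc n)
    ≡⟨ A-suc n (suc n) ⟩
  A n n + x * B n (suc n) - x * B (suc n) (suc n)
    ≡⟨ cong₂ (λ a b → a + x * B n (suc n) - x * b) (A-diagonal n) (B-suc n (suc n)) ⟩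
  ½ * H₂ n + x * B n (suc n) - x * (B n (suc n) + (t - x))
    ≡⟨ solve 4 (λ h x β t → con ½ :* h :+ x :* β :- x :* (β :+ (t :- x))
         := con ½ :* h :+ (x :* x :- con ½ :* (t :* (x :+ x)))) refl (H₂ n) x (B n (suc n)) t ⟩
  ½ * H₂ n + (x * x - ½ * (t * (x + x)))
    ≡⟨ cong (λ z → ½ * H₂ n + (x * x - ½ * z)) (sym (partialFraction n n)) ⟩
  ½ * H₂ n + (x * x - ½ * (x * x))
    ≡⟨ solve 2 (λ h x → con ½ :* h :+ (x :* x :- con ½ :* (x :* x)) := con ½ :* (h :+ x :* x)) refl (H₂ n) x ⟩
  ½ * H₂ (suc n) ∎
  where
  open ≡-Reasoning
  x = r n ; t = r (n ℕ.+ suc n)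

-- After reordering, the inner sums are the blocks `B n (suc l)` without their head `r n`, so the
-- total is `A n n` less `r n * H n`.
∑-weighted-r : ∀ n → ∑ n (λ m → (H n - H (suc m)) * r (n ℕ.+ suc m)) ≡ ½ * H₂ n - r n * H n
∑-weighted-r n = begin
  ∑ n (λ m → (H n - H (suc m)) * r (n ℕ.+ suc m))
    ≡⟨ sym (∑-harmonicWeights (λ m → r (n ℕ.+ suc m)) n) ⟩
  ∑ n (λ l → r l * ∑ l (λ m → r (n ℕ.+ suc m)))
    ≡⟨ ∑-cong (λ l → trans (solve 3 (λ y x s → y :* s := y :* (x :+ s) :+ (:- x) :* y) refl
                             (r l) (r n) (∑ l (λ m → r (n ℕ.+ suc m))))
                 (cong (λ z → r l * z + - r n * r l) (sym (head l)))) n ⟩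
  ∑ n (λ l → r l * B n (suc l) + - r n * r l)
    ≡⟨ ∑-linear (- r n) (λ l → r l * B n (suc l)) r n ⟩
  A n n + - r n * H n
    ≡⟨ cong₂ _+_ (A-diagonal n) (sym (neg-distribˡ-* (r n) (H n))) ⟩
  ½ * H₂ n - r n * H n ∎
  where
  open ≡-Reasoning
  head : ∀ l → B n (suc l) ≡ r n + ∑ l (λ m → r (n ℕ.+ suc m))
  head l = trans (∑-head (λ j → r (n ℕ.+ j)) l) (cong (λ z → r z + ∑ l (λ m → r (n ℕ.+ suc m))) (ℕ.+-identityʳ n))

-- The exact identity at finite truncation

error : ℕ → ℕ → ℚ
error b n = ∑ n (λ m → invPow m (suc b) * R n (suc m))

-- Induction on the truncation. Passing to n + 1 adds on both sides the terms with outermost index n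
-- + 1, updates each row m of `error` through `R-suc`, and creates one row on the diagonal, where
-- `A-diagonal` evaluates `R`.
rhsTr≡lhsTr+error : ∀ b → signQ (suc b) ≡ 1ℚ → ∀ n → rhsTr (3 ℕ.+ b) n ≡ lhsTr (3 ℕ.+ b) n + error b n
rhsTr≡lhsTr+error b even zero    = sym (trans (+-identityʳ _) (vanish b))
  where
  vanish : ∀ d → sumFrom2 d (λ a → signQ a * zetaTr 0 (a ∷ 1 ∷ (suc (suc b) ℕ.∸ a) ∷ [])) ≡ 0ℚ
  vanish zero    = refl
  vanish (suc d) = cong₂ _+_ (vanish d) (*-zeroʳ (signQ (suc (suc d))))
rhsTr≡lhsTr+error b even (suc n) = begin
  rhsTr w (suc n)
    ≡⟨ solve 8 (λ z₁ z₂ z₃ u₁ u₂ u₃ h₂ h → (z₁ :+ u₁ :* h₂ :- (z₂ :+ u₂ :* h)) :+ con ½ :* (z₃ :+ u₃ :* con 1ℚ)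
         := ((z₁ :- z₂) :+ con ½ :* z₃) :+ (u₁ :* h₂ :- u₂ :* h :+ con ½ :* u₃)) refl
         (zetaTr n (suc b ∷ 2 ∷ [])) (zetaTr n (suc (suc b) ∷ 1 ∷ [])) (zetaTr n (w ∷ []))
         U (invPow n (suc (suc b))) (invPow n w) (zetaTr n (2 ∷ [])) (zetaTr n (1 ∷ [])) ⟩
  rhsTr w n + (U * zetaTr n (2 ∷ []) - invPow n (suc (suc b)) * zetaTr n (1 ∷ []) + ½ * invPow n w)
    ≡⟨ cong₂ _+_ (rhsTr≡lhsTr+error b even n) increment ⟩
  lhsTr w n + error b n + U * (∑ n weighted + R (suc n) (suc n))
    ≡⟨ solve 5 (λ L E U S ρ → L :+ E :+ U :* (S :+ ρ) := L :+ ((E :+ U :* S) :+ U :* ρ)) refl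
         (lhsTr w n) (error b n) U (∑ n weighted) (R (suc n) (suc n)) ⟩
  lhsTr w n + ((error b n + U * ∑ n weighted) + U * R (suc n) (suc n))
    ≡⟨ cong (λ z → lhsTr w n + (z + U * R (suc n) (suc n))) exchange ⟩
  lhsTr w n + ((∑ n newTerms + 1ℚ * ∑ n (λ m → invPow m (suc b) * R (suc n) (suc m))) + U * R (suc n) (suc n))
    ≡⟨ solve 4 (λ L S E ρ → L :+ ((S :+ con 1ℚ :* E) :+ ρ) := (L :+ S) :+ (E :+ ρ)) refl
         (lhsTr w n) (∑ n newTerms) (∑ n (λ m → invPow m (suc b) * R (suc n) (suc m))) (U * R (suc n) (suc n)) ⟩
  (lhsTr w n + ∑ n newTerms) + error b (suc n)
    ≡⟨ cong (_+ error b (suc n)) (sym (lhsTr-suc b even n)) ⟩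
  lhsTr w (suc n) + error b (suc n) ∎
  where
  open ≡-Reasoning
  w = 3 ℕ.+ b
  x = r n
  U = invPow n (suc b)
  weighted newTerms : ℕ → ℚ
  weighted m = (H n - H (suc m)) * r (n ℕ.+ suc m)
  newTerms m = (H n - H (suc m)) * (r (n ℕ.+ suc m) * (r n * invPow m b + U))

  -- `H₂ n` splits into halves: one, with `- x * H n`, is `∑-weighted-r`; the other, with ½ x², is
  -- `A-diagonal (suc n)`. The vanishing term `(k - k) * β` restores the second summand of `R` on
  -- the diagonal.
  increment : U * zetaTr n (2 ∷ []) - invPow n (suc (suc b)) * zetaTr n (1 ∷ []) + ½ * invPow n w
    ≡ U * (∑ n weighted + R (suc n) (suc n))
  increment = begin
    U * zetaTr n (2 ∷ []) - invPow n (suc (suc b)) * zetaTr n (1 ∷ []) + ½ * invPow n w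
      ≡⟨ cong₂ (λ z z' → U * z - invPow n (suc (suc b)) * z' + ½ * invPow n w) (zetaTr-2 n) (zetaTr-1 n) ⟩
    U * H₂ n - invPow n (suc (suc b)) * H n + ½ * invPow n w
      ≡⟨ cong₂ (λ z z' → U * H₂ n - z * H n + ½ * z') (invPow-suc n (suc b))
           (trans (invPow-suc n (suc (suc b))) (cong (x *_) (invPow-suc n (suc b)))) ⟩
    U * H₂ n - x * U * H n + ½ * (x * (x * U))
      ≡⟨ solve 6 (λ U x h h₂ β k → U :* h₂ :- x :* U :* h :+ con ½ :* (x :* (x :* U))
           := U :* ((con ½ :* h₂ :- x :* h) :+ (con ½ :* (h₂ :+ x :* x) :+ (k :- k) :* β))) refl
           U x (H n) (H₂ n) (B (suc n) (suc n)) (H (suc n)) ⟩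
    U * ((½ * H₂ n - x * H n) + (½ * H₂ (suc n) + (H (suc n) - H (suc n)) * B (suc n) (suc n)))
      ≡⟨ cong₂ (λ z z' → U * (z + (z' + (H (suc n) - H (suc n)) * B (suc n) (suc n))))
           (sym (∑-weighted-r n)) (sym (A-diagonal (suc n))) ⟩
    U * (∑ n weighted + R (suc n) (suc n)) ∎

  -- The part of `newTerms` with the factor `U` is already present; the part with `invPow m b` is
  -- what each row of `error` loses. The factor `1ℚ` fits the shape of `∑-linear`.
  exchange : error b n + U * ∑ n weighted
    ≡ ∑ n newTerms + 1ℚ * ∑ n (λ m → invPow m (suc b) * R (suc n) (suc m))
  exchange = begin
    error b n + U * ∑ n weighted
      ≡⟨ sym (∑-linear U (λ m → invPow m (suc b) * R n (suc m)) weighted n) ⟩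
    ∑ n (λ m → invPow m (suc b) * R n (suc m) + U * weighted m)
      ≡⟨ ∑-cong pointwise n ⟩
    ∑ n (λ m → newTerms m + 1ℚ * (invPow m (suc b) * R (suc n) (suc m)))
      ≡⟨ ∑-linear 1ℚ newTerms (λ m → invPow m (suc b) * R (suc n) (suc m)) n ⟩
    ∑ n newTerms + 1ℚ * ∑ n (λ m → invPow m (suc b) * R (suc n) (suc m)) ∎
    where
    pointwise : ∀ m → invPow m (suc b) * R n (suc m) + U * weighted m
      ≡ newTerms m + 1ℚ * (invPow m (suc b) * R (suc n) (suc m))
    pointwise m = begin
      invPow m (suc b) * ρ + U * (g * t)
        ≡⟨ cong (λ z → z * ρ + U * (g * t)) (invPow-suc m b) ⟩
      y * Y * ρ + U * (g * t)
        ≡⟨ solve 7 (λ U x y Y g t ρ → y :* Y :* ρ :+ U :* (g :* t)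
             := g :* (t :* (x :* Y :+ U)) :+ con 1ℚ :* (y :* Y :* (ρ :+ g :* t) :- Y :* g :* (t :* (x :+ y)))) refl
             U x y Y g t ρ ⟩
      g * (t * (x * Y + U)) + 1ℚ * (y * Y * (ρ + g * t) - Y * g * (t * (x + y)))
        -- In effect y (t - x) = - t x, which turns the change of `R` in row m into the term of the
        -- left-hand side.
        ≡⟨ cong (λ z → g * (t * (x * Y + U)) + 1ℚ * (y * Y * (ρ + g * t) - Y * g * z)) (sym (partialFraction n m)) ⟩
      g * (t * (x * Y + U)) + 1ℚ * (y * Y * (ρ + g * t) - Y * g * (x * y))
        ≡⟨ solve 7 (λ P x y Y g t ρ → P :+ con 1ℚ :* (y :* Y :* (ρ :+ g :* t) :- Y :* g :* (x :* y))
             := P :+ con 1ℚ :* (y :* Y :* (ρ :+ g :* (t :- x)))) refl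
             (g * (t * (x * Y + U))) x y Y g t ρ ⟩
      g * (t * (x * Y + U)) + 1ℚ * (y * Y * (ρ + g * (t - x)))
        ≡⟨ cong₂ (λ z z' → g * (t * (x * Y + U)) + 1ℚ * (z * z')) (sym (invPow-suc m b)) (sym (R-suc n (suc m))) ⟩
      newTerms m + 1ℚ * (invPow m (suc b) * R (suc n) (suc m)) ∎
      where
      ρ = R n (suc m) ; y = r m ; Y = invPow m b
      t = r (n ℕ.+ suc m) ; g = H n - H (suc m)

-- Bounding the remainder

+-nonNeg : ∀ {p q} → 0ℚ ≤ p → 0ℚ ≤ q → 0ℚ ≤ p + q
+-nonNeg = +-mono-≤

*-nonNeg : ∀ {p q} → 0ℚ ≤ p → 0ℚ ≤ q → 0ℚ ≤ p * q
*-nonNeg {p} {q} 0≤p 0≤q =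
  nonNegative⁻¹ (p * q) {{nonNeg*nonNeg⇒nonNeg p {{nonNegative 0≤p}} q {{nonNegative 0≤q}}}}

*-monoʳ-≤ : ∀ {p q c} → 0ℚ ≤ c → p ≤ q → c * p ≤ c * q
*-monoʳ-≤ {c = c} 0≤c = *-monoˡ-≤-nonNeg c {{nonNegative 0≤c}}

*-monoˡ-≤ : ∀ {p q c} → 0ℚ ≤ c → p ≤ q → p * c ≤ q * c
*-monoˡ-≤ {c = c} 0≤c = *-monoʳ-≤-nonNeg c {{nonNegative 0≤c}}

p≤p+q : ∀ {p q} → 0ℚ ≤ q → p ≤ p + q
p≤p+q {p} 0≤q = ≤-trans (≤-reflexive (sym (+-identityʳ p))) (+-monoʳ-≤ p 0≤q)

∑-mono-≤ : ∀ {f g} n → (∀ i → i ℕ.< n → f i ≤ g i) → ∑ n f ≤ ∑ n g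
∑-mono-≤ zero    f≤g = ≤-refl
∑-mono-≤ (suc n) f≤g = +-mono-≤ (∑-mono-≤ n (λ i i<n → f≤g i (ℕ.m<n⇒m<1+n i<n))) (f≤g n ℕ.≤-refl)

∑-nonNeg : ∀ {f} n → (∀ i → i ℕ.< n → 0ℚ ≤ f i) → 0ℚ ≤ ∑ n f
∑-nonNeg zero    0≤f = ≤-refl
∑-nonNeg (suc n) 0≤f = +-nonNeg (∑-nonNeg n (λ i i<n → 0≤f i (ℕ.m<n⇒m<1+n i<n))) (0≤f n ℕ.≤-refl)

∑-const : ∀ c n → ∑ n (λ _ → c) ≡ ι n * c
∑-const c zero    = sym (trans (cong (_* c) ι-zero) (*-zeroˡ c))
∑-const c (suc n) = begin
  ∑ n (λ _ → c) + c  ≡⟨ cong (_+ c) (∑-const c n) ⟩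
  ι n * c + c        ≡⟨ solve 2 (λ k c → k :* c :+ c := (con 1ℚ :+ k) :* c) refl (ι n) c ⟩
  (1ℚ + ι n) * c     ≡⟨ cong (_* c) (sym (ι-suc n)) ⟩
  ι (suc n) * c      ∎
  where open ≡-Reasoning

∑-*ʳ : ∀ f c n → ∑ n (λ i → f i * c) ≡ ∑ n f * c
∑-*ʳ f c zero    = sym (*-zeroˡ c)
∑-*ʳ f c (suc n) = trans (cong (_+ f n * c) (∑-*ʳ f c n)) (sym (*-distribʳ-+ c (∑ n f) (f n)))

ι-mono-≤ : ∀ {m n} → m ℕ.≤ n → ι m ≤ ι n
ι-mono-≤ {m} {n} m≤n with k , refl ← ℕ.m≤n⇒∃[o]m+o≡n m≤n =
  ≤-trans (p≤p+q (ι≥0 k)) (≤-reflexive (sym (ι-homo-+ m k)))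

H-nonNeg : ∀ n → 0ℚ ≤ H n
H-nonNeg n = ∑-nonNeg n (λ i _ → r≥0 i)

H-mono-≤ : ∀ {m n} → m ℕ.≤ n → H m ≤ H n
H-mono-≤ {m} m≤n with ℕ.≤⇒≤′ m≤n
... | ℕ.≤′-refl           = ≤-refl
... | ℕ.≤′-step {n} m≤′n  = ≤-trans (H-mono-≤ (ℕ.≤′⇒≤ m≤′n)) (p≤p+q (r≥0 n))

-- The difference of the two sides is exactly t x q, with q = k + 1.
r-antitone : ∀ m k → r (m ℕ.+ suc k) ≤ r m
r-antitone m k = begin
  t                         ≤⟨ p≤p+q (*-nonNeg (*-nonNeg (r≥0 _) (r≥0 m)) (ι≥0 (suc k))) ⟩
  t + t * x * q             ≡⟨ solve 3 (λ t x q → t :+ t :* x :* q := t :* (con 1ℚ :+ x :* q)) refl t x q ⟩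
  t * (1ℚ + x * q)          ≡⟨ cong (λ z → t * (z + x * q)) (sym (r*ι≡1 m)) ⟩
  t * (x * p + x * q)       ≡⟨ solve 4 (λ t x p q → t :* (x :* p :+ x :* q) := x :* (t :* (p :+ q))) refl t x p q ⟩
  x * (t * (p + q))         ≡⟨ cong (λ z → x * (t * z)) (sym (ι-homo-+ (suc m) (suc k))) ⟩
  x * (t * ι (suc m ℕ.+ suc k)) ≡⟨ cong (x *_) (r*ι≡1 (m ℕ.+ suc k)) ⟩
  x * 1ℚ                    ≡⟨ *-identityʳ x ⟩
  x                         ∎
  where
  open ≤-Reasoning
  t = r (m ℕ.+ suc k) ; x = r m ; p = ι (suc m) ; q = ι (suc k)

r≤1 : ∀ n → r n ≤ 1ℚ
r≤1 zero    = ≤-reflexive r-zero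
r≤1 (suc n) = ≤-trans (r-antitone 0 n) (≤-reflexive r-zero)

invPow-nonNeg : ∀ n s → 0ℚ ≤ invPow n s
invPow-nonNeg n zero    = nonNegative⁻¹ 1ℚ
invPow-nonNeg n (suc s) = ≤-trans (*-nonNeg (r≥0 n) (invPow-nonNeg n s)) (≤-reflexive (sym (invPow-suc n s)))

invPow≤1 : ∀ n s → invPow n s ≤ 1ℚ
invPow≤1 n zero    = ≤-refl
invPow≤1 n (suc s) = begin
  invPow n (suc s)  ≡⟨ invPow-suc n s ⟩
  r n * invPow n s  ≤⟨ *-monoʳ-≤ (r≥0 n) (invPow≤1 n s) ⟩
  r n * 1ℚ          ≡⟨ *-identityʳ (r n) ⟩
  r n               ≤⟨ r≤1 n ⟩
  1ℚ                ∎
  where open ≤-Reasoning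

-- The factor `ι` of `R-bound` costs one power; an exponent of at least 2 still leaves 1/(n+1).
invPow*ι≤r : ∀ n s → invPow n (suc (suc s)) * ι (suc n) ≤ r n
invPow*ι≤r n s = begin
  invPow n (suc (suc s)) * q  ≡⟨ cong (_* q) (trans (invPow-suc n (suc s)) (cong (x *_) (invPow-suc n s))) ⟩
  x * (x * p) * q             ≡⟨ solve 3 (λ x p q → x :* (x :* p) :* q := x :* p :* (x :* q)) refl x p q ⟩
  x * p * (x * q)             ≡⟨ cong (x * p *_) (r*ι≡1 n) ⟩
  x * p * 1ℚ                  ≡⟨ *-identityʳ (x * p) ⟩
  x * p                       ≤⟨ *-monoʳ-≤ (r≥0 n) (invPow≤1 n s) ⟩
  x * 1ℚ                      ≡⟨ *-identityʳ x ⟩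
  x                           ∎
  where
  open ≤-Reasoning
  x = r n ; p = invPow n s ; q = ι (suc n)

B-nonNeg : ∀ n m → 0ℚ ≤ B n m
B-nonNeg n m = ∑-nonNeg m (λ j _ → r≥0 (n ℕ.+ j))

-- Stated at N = n + 1, so that `r n` is 1/N.
B-bound : ∀ n m → B (suc n) m ≤ ι m * r n
B-bound n m = ≤-trans
  (∑-mono-≤ m (λ j _ → ≤-trans (≤-reflexive (cong r (sym (ℕ.+-suc n j)))) (r-antitone n j)))
  (≤-reflexive (∑-const (r n) m))

A-nonNeg : ∀ n m → 0ℚ ≤ A n m
A-nonNeg n m = ∑-nonNeg m (λ i _ → *-nonNeg (r≥0 i) (B-nonNeg n (suc i)))

-- The factor i + 1 from `B-bound` cancels `r i`, so each of the m terms is at most `r n`.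
A-bound : ∀ n m → A (suc n) m ≤ ι m * r n
A-bound n m = ≤-trans (∑-mono-≤ m (λ i _ → term i)) (≤-reflexive (∑-const (r n) m))
  where
  open ≤-Reasoning
  term : ∀ i → r i * B (suc n) (suc i) ≤ r n
  term i = begin
    r i * B (suc n) (suc i)    ≤⟨ *-monoʳ-≤ (r≥0 i) (B-bound n (suc i)) ⟩
    r i * (ι (suc i) * r n)    ≡⟨ sym (*-assoc (r i) (ι (suc i)) (r n)) ⟩
    r i * ι (suc i) * r n      ≡⟨ cong (_* r n) (r*ι≡1 i) ⟩
    1ℚ * r n                   ≡⟨ *-identityˡ (r n) ⟩
    r n                        ∎

H-diff-nonNeg : ∀ {m n} → m ℕ.≤ n → 0ℚ ≤ H n - H m
H-diff-nonNeg {m} {n} m≤n = begin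
  0ℚ         ≡⟨ sym (+-inverseʳ (H m)) ⟩
  H m - H m  ≤⟨ +-monoˡ-≤ (- H m) (H-mono-≤ m≤n) ⟩
  H n - H m  ∎
  where open ≤-Reasoning

R-nonNeg : ∀ {m n} → m ℕ.≤ n → 0ℚ ≤ R n m
R-nonNeg {m} {n} m≤n = +-nonNeg (A-nonNeg n m) (*-nonNeg (H-diff-nonNeg m≤n) (B-nonNeg n m))

R-bound : ∀ n m → R (suc n) m ≤ ι m * (r n * (1ℚ + H (suc n)))
R-bound n m = begin
  A (suc n) m + (h - H m) * B (suc n) m
    ≤⟨ +-mono-≤ (A-bound n m) (*-monoˡ-≤ (B-nonNeg (suc n) m) dropH) ⟩
  ι m * r n + h * B (suc n) m
    ≤⟨ +-monoʳ-≤ (ι m * r n) (*-monoʳ-≤ (H-nonNeg (suc n)) (B-bound n m)) ⟩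
  ι m * r n + h * (ι m * r n)
    ≡⟨ solve 3 (λ k x h → k :* x :+ h :* (k :* x) := k :* (x :* (con 1ℚ :+ h))) refl (ι m) (r n) h ⟩
  ι m * (r n * (1ℚ + h)) ∎
  where
  open ≤-Reasoning
  h = H (suc n)
  dropH : h - H m ≤ h
  dropH = ≤-trans (+-monoʳ-≤ h (neg-antimono-≤ (H-nonNeg m))) (≤-reflexive (+-identityʳ h))

error-nonNeg : ∀ b n → 0ℚ ≤ error b n
error-nonNeg b n = ∑-nonNeg n (λ m m<n → *-nonNeg (invPow-nonNeg m (suc b)) (R-nonNeg m<n))

-- Here u = e + 2, so row m is at most `r m` times a common factor. Summing the rows gives a second
-- harmonic number, enlarged to 1 + H to form a square.
error-bound : ∀ e n → error (suc e) (suc n) ≤ r n * ((1ℚ + H (suc n)) * (1ℚ + H (suc n)))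
error-bound e n = begin
  error (suc e) (suc n)
    ≤⟨ ∑-mono-≤ (suc n) (λ m _ → term m) ⟩
  ∑ (suc n) (λ m → r m * (r n * k))
    ≡⟨ ∑-*ʳ r (r n * k) (suc n) ⟩
  H (suc n) * (r n * k)
    ≤⟨ *-monoˡ-≤ 0≤rk (≤-trans (p≤p+q {H (suc n)} (nonNegative⁻¹ 1ℚ)) (≤-reflexive (+-comm (H (suc n)) 1ℚ))) ⟩
  k * (r n * k)
    ≡⟨ solve 2 (λ k x → k :* (x :* k) := x :* (k :* k)) refl k (r n) ⟩
  r n * (k * k) ∎
  where
  open ≤-Reasoning
  k = 1ℚ + H (suc n)
  0≤rk : 0ℚ ≤ r n * k
  0≤rk = *-nonNeg (r≥0 n) (+-nonNeg (nonNegative⁻¹ 1ℚ) (H-nonNeg (suc n)))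
  term : ∀ m → invPow m (suc (suc e)) * R (suc n) (suc m) ≤ r m * (r n * k)
  term m = begin
    p * R (suc n) (suc m)               ≤⟨ *-monoʳ-≤ (invPow-nonNeg m (suc (suc e))) (R-bound n (suc m)) ⟩
    p * (ι (suc m) * (r n * k))         ≡⟨ sym (*-assoc p (ι (suc m)) (r n * k)) ⟩
    p * ι (suc m) * (r n * k)           ≤⟨ *-monoˡ-≤ 0≤rk (invPow*ι≤r m e) ⟩
    r m * (r n * k)                     ∎
    where p = invPow m (suc (suc e))

-- Sublinear growth

-- For nonnegative `a` this says that a n / n tends to 0.
Sublinear : (ℕ → ℚ) → Set
Sublinear a = ∀ ε → 0ℚ < ε → ∃ λ N → ∀ n → N ℕ.≤ n → a n ≤ ε * ι n

archimedean : ∀ q ε → 0ℚ < ε → ∃ λ k → q ≤ ε * ι k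
archimedean q ε 0<ε = let k , q/ε≤k = ≤ι (1/ ε * q) in k , (begin
  q               ≡⟨ sym (*-identityˡ q) ⟩
  1ℚ * q          ≡⟨ cong (_* q) (sym (*-inverseʳ ε)) ⟩
  ε * 1/ ε * q    ≡⟨ *-assoc ε (1/ ε) q ⟩
  ε * (1/ ε * q)  ≤⟨ *-monoʳ-≤ (<⇒≤ 0<ε) q/ε≤k ⟩
  ε * ι k         ∎)
  where
  open ≤-Reasoning
  instance
    ε≢0 : NonZero ε
    ε≢0 = pos⇒nonZero ε {{positive 0<ε}}

0<c*ε : ∀ c .{{_ : Positive c}} {ε} → 0ℚ < ε → 0ℚ < c * ε
0<c*ε c {ε} 0<ε = positive⁻¹ (c * ε) {{pos*pos⇒pos c ε {{positive 0<ε}}}}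

⅓ : ℚ
⅓ = + 1 / 3

halves : ∀ p q → ½ * p * q + ½ * p * q ≡ p * q
halves = solve 2 (λ p q → con ½ :* p :* q :+ con ½ :* p :* q := p :* q) refl

thirds : ∀ p q → ⅓ * p * q + ⅓ * p * q + ⅓ * p * q ≡ p * q
thirds = solve 2 (λ p q → con ⅓ :* p :* q :+ con ⅓ :* p :* q :+ con ⅓ :* p :* q := p :* q) refl

linearGrowth : ∀ a δ M → (∀ n → M ℕ.≤ n → a (suc n) ≤ a n + δ) → ∀ k → a (M ℕ.+ k) ≤ a M + δ * ι k
linearGrowth a δ M step zero    = ≤-reflexive (begin
  a (M ℕ.+ 0)       ≡⟨ cong a (ℕ.+-identityʳ M) ⟩
  a M               ≡⟨ solve 2 (λ x d → x := x :+ d :* con 0ℚ) refl (a M) δ ⟩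
  a M + δ * 0ℚ      ≡⟨ cong (λ z → a M + δ * z) (sym ι-zero) ⟩
  a M + δ * ι 0     ∎)
  where open ≡-Reasoning
linearGrowth a δ M step (suc k) = begin
  a (M ℕ.+ suc k)       ≡⟨ cong a (ℕ.+-suc M k) ⟩
  a (suc (M ℕ.+ k))     ≤⟨ step (M ℕ.+ k) (ℕ.m≤m+n M k) ⟩
  a (M ℕ.+ k) + δ       ≤⟨ +-monoˡ-≤ δ (linearGrowth a δ M step k) ⟩
  a M + δ * ι k + δ     ≡⟨ solve 3 (λ x d k → x :+ d :* k :+ d := x :+ d :* (con 1ℚ :+ k)) refl (a M) δ (ι k) ⟩
  a M + δ * (1ℚ + ι k)  ≡⟨ cong (λ z → a M + δ * z) (sym (ι-suc k)) ⟩
  a M + δ * ι (suc k)   ∎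
  where open ≤-Reasoning

-- Cesàro: vanishing increments force a n / n → 0.
smallIncrements⇒sublinear : ∀ a →
  (∀ ε → 0ℚ < ε → ∃ λ M → ∀ n → M ℕ.≤ n → a (suc n) ≤ a n + ε) → Sublinear a
smallIncrements⇒sublinear a small ε 0<ε =
  let M , step = small (½ * ε) (0<c*ε ½ 0<ε)
      K , aM≤  = archimedean (a M) (½ * ε) (0<c*ε ½ 0<ε)
  -- Half of ε pays for the increments after M, half for the initial value `a M`, which is at most
  -- (ε/2) K.
  in M ℕ.+ K , λ n M+K≤n →
    ≤-trans (bound (½ * ε) (<⇒≤ (0<c*ε ½ 0<ε)) M step K aM≤ n M+K≤n) (≤-reflexive (halves ε (ι n)))
  where
  open ≤-Reasoning
  bound : ∀ δ → 0ℚ ≤ δ → ∀ M → (∀ n → M ℕ.≤ n → a (suc n) ≤ a n + δ) → ∀ K → a M ≤ δ * ι K →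
    ∀ n → M ℕ.+ K ℕ.≤ n → a n ≤ δ * ι n + δ * ι n
  bound δ 0≤δ M step K aM≤ n M+K≤n with k , refl ← ℕ.m≤n⇒∃[o]m+o≡n (ℕ.m+n≤o⇒m≤o M M+K≤n) = begin
    a (M ℕ.+ k)                        ≤⟨ linearGrowth a δ M step k ⟩
    a M + δ * ι k                      ≤⟨ +-monoˡ-≤ (δ * ι k) aM≤ ⟩
    δ * ι K + δ * ι k                  ≤⟨ +-mono-≤ (*-monoʳ-≤ 0≤δ (ι-mono-≤ (ℕ.m+n≤o⇒n≤o M M+K≤n)))
                                            (*-monoʳ-≤ 0≤δ (ι-mono-≤ (ℕ.m≤n+m k M))) ⟩
    δ * ι (M ℕ.+ k) + δ * ι (M ℕ.+ k)  ∎

r*-≤ : ∀ {c ε} n → c ≤ ε * ι (suc n) → r n * c ≤ ε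
r*-≤ {c} {ε} n c≤ = begin
  r n * c                ≤⟨ *-monoʳ-≤ (r≥0 n) c≤ ⟩
  r n * (ε * ι (suc n))  ≡⟨ solve 3 (λ x e k → x :* (e :* k) := e :* (x :* k)) refl (r n) ε (ι (suc n)) ⟩
  ε * (r n * ι (suc n))  ≡⟨ cong (ε *_) (r*ι≡1 n) ⟩
  ε * 1ℚ                 ≡⟨ *-identityʳ ε ⟩
  ε                      ∎
  where open ≤-Reasoning

1+H-sublinear : Sublinear (λ n → 1ℚ + H n)
1+H-sublinear = smallIncrements⇒sublinear _ increments
  where
  open ≤-Reasoning
  increments : ∀ ε → 0ℚ < ε → ∃ λ M → ∀ n → M ℕ.≤ n → 1ℚ + H (suc n) ≤ 1ℚ + H n + ε
  increments ε 0<ε = let M , 1≤εM = archimedean 1ℚ ε 0<ε in M , λ n M≤n → begin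
    1ℚ + (H n + r n)     ≡⟨ sym (+-assoc 1ℚ (H n) (r n)) ⟩
    1ℚ + H n + r n       ≡⟨ cong (λ z → 1ℚ + H n + z) (sym (*-identityʳ (r n))) ⟩
    1ℚ + H n + r n * 1ℚ  ≤⟨ +-monoʳ-≤ (1ℚ + H n) (r*-≤ n
                              (≤-trans 1≤εM (*-monoʳ-≤ (<⇒≤ 0<ε) (ι-mono-≤ (ℕ.m≤n⇒m≤1+n M≤n))))) ⟩
    1ℚ + H n + ε         ∎

-- (h + x)² = h² + x (2h + x), and x ≤ 1 ≤ h because h contains the summand 1.
[1+H]²-step : ∀ n → (1ℚ + H (suc n)) * (1ℚ + H (suc n))
  ≤ (1ℚ + H n) * (1ℚ + H n) + r n * ((1ℚ + H n) + (1ℚ + H n) + (1ℚ + H n))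
[1+H]²-step n = begin
  (1ℚ + (H n + x)) * (1ℚ + (H n + x))
    ≡⟨ cong (λ z → z * z) (sym (+-assoc 1ℚ (H n) x)) ⟩
  (h + x) * (h + x)
    ≡⟨ solve 2 (λ h x → (h :+ x) :* (h :+ x) := h :* h :+ x :* (h :+ h :+ x)) refl h x ⟩
  h * h + x * (h + h + x)
    ≤⟨ +-monoʳ-≤ (h * h) (*-monoʳ-≤ (r≥0 n) (+-monoʳ-≤ (h + h) (≤-trans (r≤1 n) (p≤p+q (H-nonNeg n))))) ⟩
  h * h + x * (h + h + h) ∎
  where
  open ≤-Reasoning
  h = 1ℚ + H n ; x = r n

-- A second use of the Cesàro argument: the increments are at most 3h/(n+1), which is small because
-- h = 1 + H n is itself sublinear.
[1+H]²-sublinear : Sublinear (λ n → (1ℚ + H n) * (1ℚ + H n))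
[1+H]²-sublinear = smallIncrements⇒sublinear _ increments
  where
  increments : ∀ ε → 0ℚ < ε → ∃ λ M → ∀ n → M ℕ.≤ n →
    (1ℚ + H (suc n)) * (1ℚ + H (suc n)) ≤ (1ℚ + H n) * (1ℚ + H n) + ε
  increments ε 0<ε = let M , sub = 1+H-sublinear (⅓ * ε) (0<c*ε ⅓ 0<ε) in M , λ n M≤n →
    ≤-trans ([1+H]²-step n) (+-monoʳ-≤ ((1ℚ + H n) * (1ℚ + H n)) (r*-≤ n
      (≤-trans (+-mono-≤ (+-mono-≤ (sub n M≤n) (sub n M≤n)) (sub n M≤n))
        (≤-trans (≤-reflexive (thirds ε (ι n))) (*-monoʳ-≤ (<⇒≤ 0<ε) (ι-mono-≤ (ℕ.n≤1+n n)))))))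

-- Parity of the weight and passage to the limit

signQ-+2 : ∀ n → signQ (suc (suc n)) ≡ signQ n
signQ-+2 n = solve 1 (λ s → :- (:- s) := s) refl (signQ n)

signQ-even : ∀ k → signQ (k ℕ.* 2) ≡ 1ℚ
signQ-even zero    = refl
signQ-even (suc k) = trans (signQ-+2 (k ℕ.* 2)) (signQ-even k)

½*ε<ε : ∀ {ε} → 0ℚ < ε → ½ * ε < ε
½*ε<ε {ε} 0<ε = <-≤-trans (*-monoˡ-<-pos ε {{positive 0<ε}} {½} {1ℚ} (*<* (ℤ.+<+ (s≤s (s≤s z≤n)))))
  (≤-reflexive (*-identityˡ ε))

theorem5p3 : (w : ℕ) → 4 ℕ.≤ w → 2 ∣ w →
    (ε : ℚ) → 0ℚ < ε →
    ∃ λ N₀ → (N : ℕ) → N₀ ℕ.≤ N → ∣ lhsTr w N - rhsTr w N ∣ < ε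
theorem5p3 w@(suc (suc (suc (suc e)))) (s≤s (s≤s (s≤s (s≤s _)))) (divides k w≡k*2) ε 0<ε =
  -- Taking ε/2 turns the weak bound into a strict one; `suc M` makes N a successor, as
  -- `error-bound` requires.
  let M , sub = [1+H]²-sublinear (½ * ε) (0<c*ε ½ 0<ε) in suc M , close M sub
  where
  even : signQ (suc (suc e)) ≡ 1ℚ
  -- u = w - 2 has the same sign as w, which is even.
  even = trans (sym (signQ-+2 (suc (suc e)))) (trans (cong signQ w≡k*2) (signQ-even k))

  difference : ∀ N → ∣ lhsTr w N - rhsTr w N ∣ ≡ error (suc e) N
  difference N = begin
    ∣ L - rhsTr w N ∣   ≡⟨ cong (λ z → ∣ L - z ∣) (rhsTr≡lhsTr+error (suc e) even N) ⟩
    ∣ L - (L + E) ∣     ≡⟨ cong ∣_∣ (solve 2 (λ L E → L :- (L :+ E) := :- E) refl L E) ⟩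
    ∣ - E ∣             ≡⟨ ∣-p∣≡∣p∣ E ⟩
    ∣ E ∣               ≡⟨ 0≤p⇒∣p∣≡p (error-nonNeg (suc e) N) ⟩
    E                   ∎
    where
    open ≡-Reasoning
    L = lhsTr w N
    E = error (suc e) N

  close : ∀ M → (∀ n → M ℕ.≤ n → (1ℚ + H n) * (1ℚ + H n) ≤ ½ * ε * ι n) →
    ∀ N → suc M ℕ.≤ N → ∣ lhsTr w N - rhsTr w N ∣ < ε
  close M sub (suc n) (s≤s M≤n) = begin-strict
    ∣ lhsTr w (suc n) - rhsTr w (suc n) ∣             ≡⟨ difference (suc n) ⟩
    error (suc e) (suc n)                             ≤⟨ error-bound e n ⟩
    r n * ((1ℚ + H (suc n)) * (1ℚ + H (suc n)))       ≤⟨ r*-≤ n (sub (suc n) (ℕ.m≤n⇒m≤1+n M≤n)) ⟩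
    ½ * ε                                             <⟨ ½*ε<ε 0<ε ⟩
    ε                                                 ∎
    where open ≤-Reasoning
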